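{- Let $X_1,\ldots,X_n$ be pairwise disjoint nonempty finite sets, $X=\bigcup_{i=1}^n X_i$, and let $f:2^X\to\mathbb{R}_{\ge 0}$ be normalized, monotone and submodular. Let $\mathcal{G}=(V,E)$ be a directed acyclic graph on $V=\{1,\ldots,n\}$ such that every edge $(i,j)\in E$ satisfies $i<j$. Let $(x_1^*,\ldots,x_n^*)$, with $x_i^*\in X_i$ for each $i$, be an optimal solution, i.e. a maximizer of $f(x_1,\ldots,x_n)$ over all choices $x_i\in X_i$. Suppose $x_1,\ldots,x_n$ are chosen sequentially so that, for each $i\in V$, $$x_i\in\operatorname{argmax}_{x\in X_i}\Delta\big(x\mid X_{\mathrm{in}}(i)\big),\qquad X_{\mathrm{in}}(i)=\{x_j : (j,i)\in E\},$$ with ties broken arbitrarily. Then $$f(x_1,\ldots,x_n)\ \ge\ \frac{1}{(n-\omega(\mathcal{G}))+2}\, f(x_1^*,\ldots,x_n^*),$$ where $\omega(\mathcal{G})$ is the clique number of $\mathcal{G}$.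
   Context: A function $f:2^X\to\mathbb{R}_{\ge0}$ is submodular if $f(A\cup\{x\})-f(A)\ge f(B\cup\{x\})-f(B)$ for all $A\subseteq B\subseteq X$ and $x\in X\setminus B$; monotone if $f(A)\le f(B)$ whenever $A\subseteq B\subseteq X$; normalized if $f(\emptyset)=0$. The marginal reward of $x$ given $A$ is $\Delta(x\mid A)=f(A\cup\{x\})-f(A)$. The notation $f(y_1,\ldots,y_k)$ means $f(\{y_1,\ldots,y_k\})$. A complete DAG is a DAG to which no edge can be added without creating a cycle (i.e. any two distinct vertices are joined by an edge). A clique in $\mathcal{G}$ is a subgraph that is a complete DAG, and the clique number $\omega(\mathcal{G})$ is the number of vertices in a largest clique of $\mathcal{G}$. -}

module Defs where

open import Level using (0ℓ)
open import Data.Nat as ℕ using (ℕ)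
import Data.Nat.Properties as ℕ
open import Data.Rational as ℚ using (ℚ; 0ℚ; 1ℚ; ½)
import Data.Rational.Properties as ℚ
open import Data.Rational.Solver using (module +-*-Solver)
open import Data.Fin using (Fin)
import Data.Fin as Fin
open import Data.Fin.Subset
  using (Subset; _∈_; _∉_; _⊆_; _∪_; ⁅_⁆; ⋃; ∣_∣; Nonempty)
  renaming (⊥ to ∅)
open import Data.List using (List; map; filter; allFin)
open import Data.Product using (∃; _×_; _,_; proj₁; proj₂)
open import Data.Sum using (_⊎_)
open import Relation.Binary using (Rel; Decidable)
open import Relation.Binary.Construct.Closure.Transitive using (TransClosure)
open import Relation.Binary.PropositionalEquality
  using (_≡_; _≢_; refl; sym; trans; cong; subst)
open import Relation.Nullary using (¬_)

-- Real numbers: Cauchy sequences of rationals.  Equality of reals is the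
-- setoid equality _≈ℝ_, not _≡_.

Cauchy : (ℕ → ℚ) → Set
Cauchy x = ∀ ε → 0ℚ ℚ.< ε →
  ∃ λ N → ∀ m n → N ℕ.≤ m → N ℕ.≤ n → ℚ.∣ x m ℚ.- x n ∣ ℚ.≤ ε

record ℝ : Set where
  constructor mkℝ
  field
    seq    : ℕ → ℚ
    cauchy : Cauchy seq

open ℝ public

infix  4 _≤ℝ_ _≥ℝ_ _≈ℝ_
infixl 6 _+ℝ_ _-ℝ_
infixl 7 _*ℝ_
infix  8 -ℝ_

_≤ℝ_ : ℝ → ℝ → Set
x ≤ℝ y = ∀ ε → 0ℚ ℚ.< ε →
  ∃ λ N → ∀ n → N ℕ.≤ n → seq x n ℚ.≤ seq y n ℚ.+ ε

_≥ℝ_ : ℝ → ℝ → Set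
x ≥ℝ y = y ≤ℝ x

_≈ℝ_ : ℝ → ℝ → Set
x ≈ℝ y = (x ≤ℝ y) × (y ≤ℝ x)

private
  open +-*-Solver using (solve; _:=_; _:+_; _:*_; _:-_; :-_; con)

  half>0 : ∀ {ε} → 0ℚ ℚ.< ε → 0ℚ ℚ.< ½ ℚ.* ε
  half>0 {ε} ε>0 =
    subst (ℚ._< ½ ℚ.* ε) (ℚ.*-zeroʳ ½) (ℚ.*-monoʳ-<-pos ½ ε>0)

  half+half : ∀ ε → ½ ℚ.* ε ℚ.+ ½ ℚ.* ε ≡ ε
  half+half = solve 1 (λ e → con ½ :* e :+ con ½ :* e := e) refl

  -- Abstract so that comparing reals never unfolds a Cauchy proof.
  abstract
    const-cauchy : ∀ q → Cauchy (λ _ → q)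
    const-cauchy q ε ε>0 = 0 , λ _ _ _ _ →
      subst (ℚ._≤ ε) (sym (cong ℚ.∣_∣ (ℚ.+-inverseʳ q))) (ℚ.<⇒≤ ε>0)

  abstract
    +-cauchy : ∀ {x y} → Cauchy x → Cauchy y → Cauchy (λ n → x n ℚ.+ y n)
    +-cauchy {x} {y} cx cy ε ε>0
      with M , p ← cx (½ ℚ.* ε) (half>0 ε>0)
         | N , q ← cy (½ ℚ.* ε) (half>0 ε>0)
      = M ℕ.⊔ N , λ m n m≥ n≥ → begin
        ℚ.∣ (x m ℚ.+ y m) ℚ.- (x n ℚ.+ y n) ∣
          ≡⟨ cong ℚ.∣_∣ (rearrange (x m) (y m) (x n) (y n)) ⟩
        ℚ.∣ (x m ℚ.- x n) ℚ.+ (y m ℚ.- y n) ∣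
          ≤⟨ ℚ.∣p+q∣≤∣p∣+∣q∣ (x m ℚ.- x n) (y m ℚ.- y n) ⟩
        ℚ.∣ x m ℚ.- x n ∣ ℚ.+ ℚ.∣ y m ℚ.- y n ∣
          ≤⟨ ℚ.+-mono-≤
               (p m n (ℕ.m⊔n≤o⇒m≤o M N m≥) (ℕ.m⊔n≤o⇒m≤o M N n≥))
               (q m n (ℕ.m⊔n≤o⇒n≤o M N m≥) (ℕ.m⊔n≤o⇒n≤o M N n≥)) ⟩
        ½ ℚ.* ε ℚ.+ ½ ℚ.* ε
          ≡⟨ half+half ε ⟩
        ε ∎
      where
      open ℚ.≤-Reasoning
      rearrange : ∀ a b c d →
        (a ℚ.+ b) ℚ.- (c ℚ.+ d) ≡ (a ℚ.- c) ℚ.+ (b ℚ.- d)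
      rearrange = solve 4
        (λ a b c d → (a :+ b) :- (c :+ d) := (a :- c) :+ (b :- d)) refl

  abstract
    neg-cauchy : ∀ {x} → Cauchy x → Cauchy (λ n → ℚ.- x n)
    neg-cauchy {x} cx ε ε>0 with N , p ← cx ε ε>0
      = N , λ m n m≥ n≥ →
        subst (ℚ._≤ ε)
          (trans (sym (ℚ.∣-p∣≡∣p∣ (x m ℚ.- x n)))
                 (cong ℚ.∣_∣ (rearrange (x m) (x n))))
          (p m n m≥ n≥)
      where
      rearrange : ∀ a b → ℚ.- (a ℚ.- b) ≡ (ℚ.- a) ℚ.- (ℚ.- b)
      rearrange = solve 2 (λ a b → :- (a :- b) := (:- a) :- (:- b)) refl

  bounded : ∀ {x} → Cauchy x →
    ∃ λ K → 0ℚ ℚ.< K × ∃ λ N → ∀ n → N ℕ.≤ n → ℚ.∣ x n ∣ ℚ.≤ K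
  bounded {x} cx with N , p ← cx 1ℚ (ℚ.positive⁻¹ 1ℚ)
    = 1ℚ ℚ.+ ℚ.∣ x N ∣
    , ℚ.+-mono-<-≤ (ℚ.positive⁻¹ 1ℚ) (ℚ.0≤∣p∣ (x N))
    , N
    , λ n n≥ → begin
      ℚ.∣ x n ∣
        ≡⟨ cong ℚ.∣_∣ (rearrange (x n) (x N)) ⟩
      ℚ.∣ (x n ℚ.- x N) ℚ.+ x N ∣
        ≤⟨ ℚ.∣p+q∣≤∣p∣+∣q∣ (x n ℚ.- x N) (x N) ⟩
      ℚ.∣ x n ℚ.- x N ∣ ℚ.+ ℚ.∣ x N ∣
        ≤⟨ ℚ.+-monoˡ-≤ ℚ.∣ x N ∣ (p n N n≥ ℕ.≤-refl) ⟩
      1ℚ ℚ.+ ℚ.∣ x N ∣ ∎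
    where
    open ℚ.≤-Reasoning
    rearrange : ∀ a b → a ≡ (a ℚ.- b) ℚ.+ b
    rearrange = solve 2 (λ a b → a := (a :- b) :+ b) refl

  shrink : ∀ {K ε} → 0ℚ ℚ.< K → 0ℚ ℚ.< ε →
    ∃ λ δ → 0ℚ ℚ.< δ × K ℚ.* δ ≡ ε
  shrink {K} {ε} K>0 ε>0 =
    K⁻¹ ℚ.* ε
    , subst (ℚ._< K⁻¹ ℚ.* ε) (ℚ.*-zeroʳ K⁻¹) (ℚ.*-monoʳ-<-pos K⁻¹ ε>0)
    , trans (sym (ℚ.*-assoc K K⁻¹ ε))
        (trans (cong (ℚ._* ε) (ℚ.*-inverseʳ K)) (ℚ.*-identityˡ ε))
    where
    instance
      K-pos = ℚ.positive K>0
      K-nonZero = ℚ.pos⇒nonZero K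
    K⁻¹ = ℚ.1/ K
    instance K⁻¹-pos = ℚ.1/pos⇒pos K

  *-bound : ∀ {a b K δ} → 0ℚ ℚ.< K → ℚ.∣ a ∣ ℚ.≤ K → ℚ.∣ b ∣ ℚ.≤ δ →
    ℚ.∣ a ℚ.* b ∣ ℚ.≤ K ℚ.* δ
  *-bound {a} {b} {K} {δ} K>0 a≤K b≤δ = begin
    ℚ.∣ a ℚ.* b ∣         ≡⟨ ℚ.∣p*q∣≡∣p∣*∣q∣ a b ⟩
    ℚ.∣ a ∣ ℚ.* ℚ.∣ b ∣   ≤⟨ ℚ.*-monoʳ-≤-nonNeg ℚ.∣ b ∣ a≤K ⟩
    K ℚ.* ℚ.∣ b ∣         ≤⟨ ℚ.*-monoˡ-≤-nonNeg K b≤δ ⟩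
    K ℚ.* δ               ∎
    where
    open ℚ.≤-Reasoning
    instance
      K-nonNeg = ℚ.nonNegative (ℚ.<⇒≤ K>0)
      ∣b∣-nonNeg = ℚ.nonNegative (ℚ.0≤∣p∣ b)

  *-close : ∀ {a b c d K L δ η ε} → 0ℚ ℚ.< K → 0ℚ ℚ.< L →
    ℚ.∣ a ∣ ℚ.≤ K → ℚ.∣ d ∣ ℚ.≤ L →
    ℚ.∣ b ℚ.- d ∣ ℚ.≤ δ → ℚ.∣ a ℚ.- c ∣ ℚ.≤ η →
    K ℚ.* δ ≡ ½ ℚ.* ε → L ℚ.* η ≡ ½ ℚ.* ε →
    ℚ.∣ a ℚ.* b ℚ.- c ℚ.* d ∣ ℚ.≤ ε
  *-close {a} {b} {c} {d} {K} {L} {δ} {η} {ε}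
    K>0 L>0 a≤K d≤L b-d≤δ a-c≤η Kδ≡ Lη≡ = begin
      ℚ.∣ a ℚ.* b ℚ.- c ℚ.* d ∣
        ≡⟨ cong ℚ.∣_∣ (rearrange a b c d) ⟩
      ℚ.∣ a ℚ.* (b ℚ.- d) ℚ.+ d ℚ.* (a ℚ.- c) ∣
        ≤⟨ ℚ.∣p+q∣≤∣p∣+∣q∣ (a ℚ.* (b ℚ.- d)) (d ℚ.* (a ℚ.- c)) ⟩
      ℚ.∣ a ℚ.* (b ℚ.- d) ∣ ℚ.+ ℚ.∣ d ℚ.* (a ℚ.- c) ∣
        ≤⟨ ℚ.+-mono-≤ (*-bound {a} {b ℚ.- d} {K} {δ} K>0 a≤K b-d≤δ)
                      (*-bound {d} {a ℚ.- c} {L} {η} L>0 d≤L a-c≤η) ⟩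
      K ℚ.* δ ℚ.+ L ℚ.* η
        ≡⟨ trans (cong (ℚ._+ L ℚ.* η) Kδ≡) (cong (½ ℚ.* ε ℚ.+_) Lη≡) ⟩
      ½ ℚ.* ε ℚ.+ ½ ℚ.* ε
        ≡⟨ half+half ε ⟩
      ε ∎
    where
    open ℚ.≤-Reasoning
    rearrange : ∀ a b c d →
      a ℚ.* b ℚ.- c ℚ.* d ≡ a ℚ.* (b ℚ.- d) ℚ.+ d ℚ.* (a ℚ.- c)
    rearrange = solve 4
      (λ a b c d → a :* b :- c :* d := a :* (b :- d) :+ d :* (a :- c)) refl

  abstract
    *-cauchy : ∀ {x y} → Cauchy x → Cauchy y → Cauchy (λ n → x n ℚ.* y n)
    *-cauchy {x} {y} cx cy ε ε>0 =
      let K , K>0 , A , x≤K = bounded {x} cx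
          L , L>0 , B , y≤L = bounded {y} cy
          δ , δ>0 , Kδ≡ = shrink {K} {½ ℚ.* ε} K>0 (half>0 ε>0)
          η , η>0 , Lη≡ = shrink {L} {½ ℚ.* ε} L>0 (half>0 ε>0)
          M , p = cx η η>0
          N , q = cy δ δ>0
      in (A ℕ.⊔ B) ℕ.⊔ (M ℕ.⊔ N) , λ m n m≥ n≥ →
        let m≥AB = ℕ.m⊔n≤o⇒m≤o (A ℕ.⊔ B) (M ℕ.⊔ N) m≥
            n≥AB = ℕ.m⊔n≤o⇒m≤o (A ℕ.⊔ B) (M ℕ.⊔ N) n≥
            m≥MN = ℕ.m⊔n≤o⇒n≤o (A ℕ.⊔ B) (M ℕ.⊔ N) m≥
            n≥MN = ℕ.m⊔n≤o⇒n≤o (A ℕ.⊔ B) (M ℕ.⊔ N) n≥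
        in *-close {x m} {y m} {x n} {y n} {K} {L} {δ} {η} {ε} K>0 L>0
             (x≤K m (ℕ.m⊔n≤o⇒m≤o A B m≥AB))
             (y≤L n (ℕ.m⊔n≤o⇒n≤o A B n≥AB))
             (q m n (ℕ.m⊔n≤o⇒n≤o M N m≥MN) (ℕ.m⊔n≤o⇒n≤o M N n≥MN))
             (p m n (ℕ.m⊔n≤o⇒m≤o M N m≥MN) (ℕ.m⊔n≤o⇒m≤o M N n≥MN))
             Kδ≡ Lη≡

fromℚ : ℚ → ℝ
fromℚ q = mkℝ (λ _ → q) (const-cauchy q)

0ℝ : ℝ
0ℝ = fromℚ 0ℚ

_+ℝ_ : ℝ → ℝ → ℝ
x +ℝ y = mkℝ (λ n → seq x n ℚ.+ seq y n)
         (+-cauchy {seq x} {seq y} (cauchy x) (cauchy y))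

-ℝ_ : ℝ → ℝ
-ℝ x = mkℝ (λ n → ℚ.- seq x n) (neg-cauchy {seq x} (cauchy x))

_-ℝ_ : ℝ → ℝ → ℝ
x -ℝ y = x +ℝ (-ℝ y)

_*ℝ_ : ℝ → ℝ → ℝ
x *ℝ y = mkℝ (λ n → seq x n ℚ.* seq y n)
         (*-cauchy {seq x} {seq y} (cauchy x) (cauchy y))

-- The ground set is Fin m, so 2^X is Subset m.
SetFunction : ℕ → Set
SetFunction m = Subset m → ℝ

module _ {m : ℕ} (f : SetFunction m) where

  -- Encodes the codomain ℝ≥0.
  NonNegative : Set
  NonNegative = ∀ A → 0ℝ ≤ℝ f A

  Normalized : Set
  Normalized = f ∅ ≈ℝ 0ℝ

  Monotone : Set
  Monotone = ∀ A B → A ⊆ B → f A ≤ℝ f B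

  Δ[_∣_] : Fin m → Subset m → ℝ
  Δ[ x ∣ A ] = f (A ∪ ⁅ x ⁆) -ℝ f A

  Submodular : Set
  Submodular = ∀ A B → A ⊆ B → ∀ x → x ∉ B →
    f (A ∪ ⁅ x ⁆) -ℝ f A ≥ℝ f (B ∪ ⁅ x ⁆) -ℝ f B

-- {y₁ , … , yₖ} as a subset of the ground set.
setOf : ∀ {m} → List (Fin m) → Subset m
setOf ys = ⋃ (map ⁅_⁆ ys)

-- X₁ , … , Xₙ are pairwise disjoint and nonempty, with union the whole
-- ground set Fin m.
record IsPartition {m n} (X : Fin n → Subset m) : Set where
  field
    nonempty : ∀ i → Nonempty (X i)
    disjoint : ∀ i j → i ≢ j → ∀ x → x ∈ X i → x ∉ X j
    covers   : ∀ x → ∃ λ i → x ∈ X i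

-- f(x₁ , … , xₙ)
value : ∀ {m n} → SetFunction m → (Fin n → Fin m) → ℝ
value {n = n} f x = f (setOf (map x (allFin n)))

Feasible : ∀ {m n} → (Fin n → Subset m) → (Fin n → Fin m) → Set
Feasible X x = ∀ i → x i ∈ X i

IsOptimal : ∀ {m n} → SetFunction m → (Fin n → Subset m) →
            (Fin n → Fin m) → Set
IsOptimal f X x* =
  Feasible X x* × (∀ y → Feasible X y → value f y ≤ℝ value f x*)

Acyclic : ∀ {n} → Rel (Fin n) 0ℓ → Set
Acyclic R = ∀ i → ¬ TransClosure R i i

record DAG (n : ℕ) : Set₁ where
  field
    Edge    : Rel (Fin n) 0ℓ
    edge?   : Decidable Edge
    acyclic : Acyclic Edge

open DAG public

record Subgraph {n} (G : DAG n) : Set₁ where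
  field
    vertices : Subset n
    edge     : Rel (Fin n) 0ℓ
    edge⊆    : ∀ {i j} → edge i j → Edge G i j
    ends∈    : ∀ {i j} → edge i j → i ∈ vertices × j ∈ vertices

open Subgraph public

IsCompleteDAG : ∀ {n} {G : DAG n} → Subgraph G → Set
IsCompleteDAG H =
  Acyclic (edge H) ×
  (∀ i j → i ∈ vertices H → j ∈ vertices H → i ≢ j →
    edge H i j ⊎ edge H j i)

record Clique {n} (G : DAG n) : Set₁ where
  field
    subgraph : Subgraph G
    complete : IsCompleteDAG subgraph

  size : ℕ
  size = ∣ vertices subgraph ∣

IsCliqueNumber : ∀ {n} → DAG n → ℕ → Set₁
IsCliqueNumber G ω =
  (∃ λ (C : Clique G) → Clique.size C ≡ ω) ×
  (∀ (C : Clique G) → Clique.size C ℕ.≤ ω)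

-- X_in(i) = {x_j : (j , i) ∈ E}
X-in : ∀ {m n} → DAG n → (Fin n → Fin m) → Fin n → Subset m
X-in {n = n} G x i = setOf (map x (filter (λ j → edge? G j i) (allFin n)))

IsArgmax : ∀ {m} → Subset m → (Fin m → ℝ) → Fin m → Set
IsArgmax S g x = x ∈ S × (∀ z → z ∈ S → g z ≤ℝ g x)

-- When edges go from smaller to larger indices, X-in G x i only involves
-- choices made before i, so this describes exactly the possible outcomes
-- of the sequential procedure, under any tie-breaking.
IsGreedy : ∀ {m n} → SetFunction m → (Fin n → Subset m) → DAG n →
           (Fin n → Fin m) → Set
IsGreedy f X G x =
  ∀ i → IsArgmax (X i) (λ z → Δ[_∣_] f z (X-in G x i)) (x i)

{-# OPTIONS --safe #-}

-- Let S = {x₁ , … , xₙ}, O = {x₁* , … , xₙ*}, and let C be a maximum clique.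
-- Submodularity, then greediness, give
--   f(O) ≤ f(S) + Σᵢ Δ(xᵢ* ∣ X_in(i)) ≤ f(S) + Σᵢ Δ(xᵢ ∣ X_in(i)).
-- For i ∉ C bound Δ(xᵢ ∣ X_in(i)) by f(S): together these terms contribute at
-- most (n − ω) f(S).  For i ∈ C, X_in(i) contains all earlier xⱼ with j ∈ C,
-- so these terms are dominated by the telescoping marginals of
-- {xⱼ : j ∈ C} ⊆ S and contribute at most f(S).
module Submission where

open import Defs
open import Data.Nat using (ℕ; zero; suc; _+_; _∸_)
import Data.Nat as ℕ
import Data.Nat.Properties as ℕ
open import Data.Integer using (+_)
import Data.Integer as ℤ
import Data.Integer.Properties as ℤ
open import Data.Rational as ℚ using (0ℚ; 1ℚ; ½; _/_)
import Data.Rational.Properties as ℚ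
import Data.Rational.Unnormalised as ℚᵘ
import Data.Rational.Unnormalised.Properties as ℚᵘ
open import Data.Rational.Solver using (module +-*-Solver)
open import Data.Fin using (Fin; _<_; zero; suc)
import Data.Fin.Properties as Fin
open import Data.Fin.Subset
  using (Subset; _∈_; _⊆_; _∪_; ⁅_⁆; ∣_∣; inside; outside)
  renaming (⊥ to ∅)
open import Data.Fin.Subset.Properties
open import Data.List using (List; []; _∷_; map; filter; length; tabulate; allFin)
open import Data.List.Membership.Propositional renaming (_∈_ to _∈ˡ_)
open import Data.List.Membership.Propositional.Properties
  using (∈-filter⁺; ∈-allFin; ∈-map⁺)
open import Data.List.Relation.Unary.All using (lookup)
open import Data.List.Relation.Unary.AllPairs using (AllPairs; []; _∷_)
import Data.List.Relation.Unary.AllPairs.Properties as AllPairs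
import Data.List.Relation.Unary.Any as Any
open import Data.Product using (_,_; proj₁; proj₂)
open import Data.Sum using (inj₁; inj₂; [_,_]′)
open import Data.Vec using ([]; _∷_; here; there)
open import Function using (_∘_; id)
open import Level using (0ℓ)
open import Relation.Binary using (Preorder)
open import Relation.Binary.PropositionalEquality
  using (_≡_; refl; sym; trans; cong; subst)
import Relation.Binary.Reasoning.Preorder as PreorderReasoning
open import Relation.Nullary using (yes; no; contradiction)
open import Relation.Nullary.Decidable using (¬?)

open +-*-Solver using (solve; _:=_; _:+_; _:*_; _:-_; con)

-- Real numbers

half>0 : ∀ {ε} → 0ℚ ℚ.< ε → 0ℚ ℚ.< ½ ℚ.* ε
half>0 {ε} ε>0 =
  subst (ℚ._< ½ ℚ.* ε) (ℚ.*-zeroʳ ½) (ℚ.*-monoʳ-<-pos ½ ε>0)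

pointwise⇒≤ℝ : ∀ x y → (∀ n → seq x n ≡ seq y n) → x ≤ℝ y
pointwise⇒≤ℝ x y eq ε ε>0 = 0 , λ n _ →
  subst (ℚ._≤ seq y n ℚ.+ ε) (trans (ℚ.+-identityʳ (seq y n)) (sym (eq n)))
    (ℚ.+-monoʳ-≤ (seq y n) (ℚ.<⇒≤ ε>0))

-- Arithmetic on reals acts index by index, so a ring identity between reals reduces to one in ℚ at
-- each index, with no ε to manage.
pointwise⇒≈ℝ : ∀ x y → (∀ n → seq x n ≡ seq y n) → x ≈ℝ y
pointwise⇒≈ℝ x y eq = pointwise⇒≤ℝ x y eq , pointwise⇒≤ℝ y x (sym ∘ eq)

≤ℝ-refl : ∀ x → x ≤ℝ x
≤ℝ-refl x = pointwise⇒≤ℝ x x λ _ → refl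

≤ℝ-trans : ∀ x y z → x ≤ℝ y → y ≤ℝ z → x ≤ℝ z
≤ℝ-trans x y z x≤y y≤z ε ε>0
  with M , p ← x≤y (½ ℚ.* ε) (half>0 ε>0)
     | N , q ← y≤z (½ ℚ.* ε) (half>0 ε>0)
  = M ℕ.⊔ N , λ n n≥ → begin
    seq x n
      ≤⟨ p n (ℕ.m⊔n≤o⇒m≤o M N n≥) ⟩
    seq y n ℚ.+ ½ ℚ.* ε
      ≤⟨ ℚ.+-monoˡ-≤ (½ ℚ.* ε) (q n (ℕ.m⊔n≤o⇒n≤o M N n≥)) ⟩
    (seq z n ℚ.+ ½ ℚ.* ε) ℚ.+ ½ ℚ.* ε
      ≡⟨ solve 2 (λ z e → (z :+ con ½ :* e) :+ con ½ :* e := z :+ e)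
           refl (seq z n) ε ⟩
    seq z n ℚ.+ ε ∎
  where open ℚ.≤-Reasoning

+ℝ-mono-≤ : ∀ x y u v → x ≤ℝ y → u ≤ℝ v → x +ℝ u ≤ℝ y +ℝ v
+ℝ-mono-≤ x y u v x≤y u≤v ε ε>0
  with M , p ← x≤y (½ ℚ.* ε) (half>0 ε>0)
     | N , q ← u≤v (½ ℚ.* ε) (half>0 ε>0)
  = M ℕ.⊔ N , λ n n≥ → begin
    seq x n ℚ.+ seq u n
      ≤⟨ ℚ.+-mono-≤ (p n (ℕ.m⊔n≤o⇒m≤o M N n≥)) (q n (ℕ.m⊔n≤o⇒n≤o M N n≥)) ⟩
    (seq y n ℚ.+ ½ ℚ.* ε) ℚ.+ (seq v n ℚ.+ ½ ℚ.* ε)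
      ≡⟨ solve 3 (λ y v e → (y :+ con ½ :* e) :+ (v :+ con ½ :* e)
                         := (y :+ v) :+ e)
           refl (seq y n) (seq v n) ε ⟩
    (seq y n ℚ.+ seq v n) ℚ.+ ε ∎
  where open ℚ.≤-Reasoning

+ℝ-monoˡ-≤ : ∀ z x y → x ≤ℝ y → x +ℝ z ≤ℝ y +ℝ z
+ℝ-monoˡ-≤ z x y x≤y = +ℝ-mono-≤ x y z z x≤y (≤ℝ-refl z)

+ℝ-monoʳ-≤ : ∀ z x y → x ≤ℝ y → z +ℝ x ≤ℝ z +ℝ y
+ℝ-monoʳ-≤ z x y = +ℝ-mono-≤ z z x y (≤ℝ-refl z)

*ℝ-monoʳ-≤-pos : ∀ c x y → 0ℚ ℚ.< c → x ≤ℝ y →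
  fromℚ c *ℝ x ≤ℝ fromℚ c *ℝ y
*ℝ-monoʳ-≤-pos c x y c>0 x≤y ε ε>0
  -- The tolerance is chosen so that multiplication by `c` turns it back into `ε`.
  = let N , p = x≤y (c⁻¹ ℚ.* ε) c⁻¹ε>0 in N , λ n n≥ → begin
    c ℚ.* seq x n
      ≤⟨ ℚ.*-monoˡ-≤-nonNeg c (p n n≥) ⟩
    c ℚ.* (seq y n ℚ.+ c⁻¹ ℚ.* ε)
      ≡⟨ solve 4 (λ c d y e → c :* (y :+ d :* e) := c :* y :+ (c :* d) :* e)
           refl c c⁻¹ (seq y n) ε ⟩
    c ℚ.* seq y n ℚ.+ (c ℚ.* c⁻¹) ℚ.* ε
      ≡⟨ cong (λ r → c ℚ.* seq y n ℚ.+ r ℚ.* ε) (ℚ.*-inverseʳ c) ⟩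
    c ℚ.* seq y n ℚ.+ 1ℚ ℚ.* ε
      ≡⟨ cong (c ℚ.* seq y n ℚ.+_) (ℚ.*-identityˡ ε) ⟩
    c ℚ.* seq y n ℚ.+ ε ∎
  where
  open ℚ.≤-Reasoning
  instance
    c-pos     = ℚ.positive c>0
    c-nonNeg  = ℚ.nonNegative (ℚ.<⇒≤ c>0)
    c-nonZero = ℚ.pos⇒nonZero c
  c⁻¹ = ℚ.1/ c
  instance c⁻¹-pos = ℚ.1/pos⇒pos c
  c⁻¹ε>0 : 0ℚ ℚ.< c⁻¹ ℚ.* ε
  c⁻¹ε>0 = subst (ℚ._< c⁻¹ ℚ.* ε) (ℚ.*-zeroʳ c⁻¹) (ℚ.*-monoʳ-<-pos c⁻¹ ε>0)

≤ℝ-preorder : Preorder 0ℓ 0ℓ 0ℓ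
≤ℝ-preorder = record
  { Carrier    = ℝ
  ; _≈_        = _≈ℝ_
  ; _≲_        = _≤ℝ_
  ; isPreorder = record
    { isEquivalence = record
      { refl  = λ {x} → ≤ℝ-refl x , ≤ℝ-refl x
      ; sym   = λ (p , q) → q , p
      ; trans = λ {x} {y} {z} (p , q) (r , s) →
          ≤ℝ-trans x y z p r , ≤ℝ-trans z y x s q
      }
    ; reflexive = proj₁
    ; trans     = λ {x} {y} {z} → ≤ℝ-trans x y z
    }
  }

open PreorderReasoning ≤ℝ-preorder

-- Natural multiples and finite sums of reals

infixr 7 _·_

-- Repeated addition, so that an induction can split off one copy of `r` definitionally; `seq-·`
-- relates it to rational scaling.
_·_ : ℕ → ℝ → ℝ
zero  · r = 0ℝ
suc k · r = r +ℝ k · r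

-- `_/_` divides out a gcd, which does not compute for a variable `k`. In the unnormalised rationals
-- the claim becomes an identity of integers.
suc/1 : ∀ k → + suc k / 1 ≡ 1ℚ ℚ.+ + k / 1
suc/1 k = ℚ.toℚᵘ-injective (ℚᵘ.≃-trans (ℚ.toℚᵘ-fromℚᵘ (ℚᵘ.mkℚᵘ (+ suc k) 0))
  (ℚᵘ.≃-sym (ℚᵘ.≃-trans (ℚ.toℚᵘ-homo-+ 1ℚ (+ k / 1))
    (ℚᵘ.≃-trans (ℚᵘ.+-congʳ ℚᵘ.1ℚᵘ (ℚ.toℚᵘ-fromℚᵘ (ℚᵘ.mkℚᵘ (+ k) 0)))
      (ℚᵘ.*≡* (cong (λ z → (+ 1 ℤ.+ z) ℤ.* + 1) (ℤ.*-identityʳ (+ k))))))))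

1/k*k≡1 : ∀ k → (+ 1 / suc k) ℚ.* (+ suc k / 1) ≡ 1ℚ
1/k*k≡1 k = ℚ.toℚᵘ-injective
  (ℚᵘ.≃-trans (ℚ.toℚᵘ-homo-* (+ 1 / suc k) (+ suc k / 1))
    (ℚᵘ.≃-trans (ℚᵘ.*-cong (ℚ.toℚᵘ-fromℚᵘ (ℚᵘ.mkℚᵘ (+ 1) k))
                           (ℚ.toℚᵘ-fromℚᵘ (ℚᵘ.mkℚᵘ (+ suc k) 0)))
      (ℚᵘ.*≡* (trans (ℤ.*-identityʳ _)
        (trans (ℤ.*-identityˡ (+ suc k))
          (sym (trans (ℤ.*-identityˡ _) (cong +_ (ℕ.*-identityʳ (suc k))))))))))

seq-· : ∀ k r n → seq (k · r) n ≡ (+ k / 1) ℚ.* seq r n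
seq-· zero    r n = sym (ℚ.*-zeroˡ (seq r n))
seq-· (suc k) r n =
  trans (cong (seq r n ℚ.+_) (seq-· k r n))
    (trans (solve 2 (λ r c → r :+ c :* r := (con 1ℚ :+ c) :* r)
             refl (seq r n) (+ k / 1))
      (cong (ℚ._* seq r n) (sym (suc/1 k))))

≤·⇒1/*≤ : ∀ k x y → x ≤ℝ suc k · y → fromℚ (+ 1 / suc k) *ℝ x ≤ℝ y
≤·⇒1/*≤ k x y x≤ = begin
  fromℚ c *ℝ x            ≲⟨ *ℝ-monoʳ-≤-pos c x (suc k · y) (ℚ.positive⁻¹ c) x≤ ⟩
  fromℚ c *ℝ (suc k · y)  ≈⟨ pointwise⇒≈ℝ (fromℚ c *ℝ (suc k · y)) y cancel ⟩
  y                       ∎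
  where
  c = + 1 / suc k
  instance c-pos = ℚ.normalize-pos 1 (suc k)
  cancel : ∀ n → c ℚ.* seq (suc k · y) n ≡ seq y n
  cancel n = trans (cong (c ℚ.*_) (seq-· (suc k) y n))
    (trans (sym (ℚ.*-assoc c (+ suc k / 1) (seq y n)))
      (trans (cong (ℚ._* seq y n) (1/k*k≡1 k)) (ℚ.*-identityˡ (seq y n))))

∑ : ∀ {A : Set} → (A → ℝ) → List A → ℝ
∑ g []       = 0ℝ
∑ g (i ∷ is) = g i +ℝ ∑ g is

∑-mono : ∀ {A : Set} {g h : A → ℝ} (is : List A) →
  (∀ i → g i ≤ℝ h i) → ∑ g is ≤ℝ ∑ h is
∑-mono                 []       g≤h = ≤ℝ-refl 0ℝ
∑-mono {g = g} {h = h} (i ∷ is) g≤h =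
  +ℝ-mono-≤ (g i) (h i) (∑ g is) (∑ h is) (g≤h i) (∑-mono is g≤h)

x+[y-x]≈y : ∀ x y → x +ℝ (y -ℝ x) ≈ℝ y
x+[y-x]≈y x y = pointwise⇒≈ℝ (x +ℝ (y -ℝ x)) y λ n →
  solve 2 (λ x y → x :+ (y :- x) := y) refl (seq x n) (seq y n)

+ℝ-assoc : ∀ x y z → (x +ℝ y) +ℝ z ≈ℝ x +ℝ (y +ℝ z)
+ℝ-assoc x y z = pointwise⇒≈ℝ ((x +ℝ y) +ℝ z) (x +ℝ (y +ℝ z)) λ n →
  ℚ.+-assoc (seq x n) (seq y n) (seq z n)

+ℝ-identityʳ : ∀ x → x +ℝ 0ℝ ≈ℝ x
+ℝ-identityʳ x = pointwise⇒≈ℝ (x +ℝ 0ℝ) x λ n → ℚ.+-identityʳ (seq x n)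

-- Finite subsets

∪-lub : ∀ {m} {A B C : Subset m} → A ⊆ C → B ⊆ C → A ∪ B ⊆ C
∪-lub {A = A} {B} A⊆C B⊆C x∈ = [ A⊆C , B⊆C ]′ (x∈p∪q⁻ A B x∈)

⁅⁆⊆ : ∀ {m} {x : Fin m} {A : Subset m} → x ∈ A → ⁅ x ⁆ ⊆ A
⁅⁆⊆ {x = x} {A} x∈A y∈ = subst (_∈ A) (sym (x∈⁅y⁆⇒x≡y x y∈)) x∈A

∈-setOf : ∀ {m} {y : Fin m} {ys} → y ∈ˡ ys → y ∈ setOf ys
∈-setOf {y = y} {ys = _ ∷ ys} (Any.here refl) = p⊆p∪q (setOf ys) (x∈⁅x⁆ y)
∈-setOf {ys = z ∷ ys}         (Any.there y∈)  =
  q⊆p∪q ⁅ z ⁆ (setOf ys) (∈-setOf y∈)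

-- For the induction `C` stays fixed while `h` is shifted by `suc`; the two inclusions say that `p`
-- is the preimage of `C` under `h`. The intended case is `h = id`, `p = C`.
filter-∉-count : ∀ {n} (C : Subset n) {k} (p : Subset k) (h : Fin k → Fin n) →
  (∀ {j} → j ∈ p → h j ∈ C) → (∀ {j} → h j ∈ C → j ∈ p) →
  length (filter (λ i → ¬? (i ∈? C)) (tabulate h)) + ∣ p ∣ ≡ k
filter-∉-count C []      h p⇒C C⇒p = refl
filter-∉-count C (s ∷ p) h p⇒C C⇒p
  with ih ← filter-∉-count C p (h ∘ suc) (p⇒C ∘ there) (drop-there ∘ C⇒p)
  with h zero ∈? C | s
... | yes _   | inside  = trans (ℕ.+-suc _ _) (cong suc ih)
... | no  _   | outside = cong suc ih
... | yes h∈C | outside = contradiction (C⇒p h∈C) λ ()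
... | no  h∉C | inside  = contradiction (p⇒C here) h∉C

∣allFin∖∣≡n∸∣∣ : ∀ {n} (C : Subset n) →
  length (filter (λ i → ¬? (i ∈? C)) (allFin n)) ≡ n ∸ ∣ C ∣
∣allFin∖∣≡n∸∣∣ C = trans (sym (ℕ.m+n∸n≡m _ ∣ C ∣))
  (cong (_∸ ∣ C ∣) (filter-∉-count C C id id id))

-- Completeness gives an edge in one of the two directions, and the backward one would run from a
-- larger index to a smaller.
clique-edge : ∀ {n} {G : DAG n} → (∀ {i j} → Edge G i j → i < j) →
  (K : Clique G) → let C = vertices (Clique.subgraph K) in
  ∀ {i j} → i ∈ C → j ∈ C → i < j → Edge G i j
clique-edge E⇒< K i∈C j∈C i<j
  with proj₂ (Clique.complete K) _ _ i∈C j∈C (Fin.<⇒≢ i<j)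
... | inj₁ e = edge⊆ (Clique.subgraph K) e
... | inj₂ e = contradiction (E⇒< (edge⊆ (Clique.subgraph K) e)) (Fin.<-asym i<j)

-- Monotone submodular functions

module _ {m} (f : SetFunction m) (mono : Monotone f) (submod : Submodular f) where


  private
    Δ : Fin m → Subset m → ℝ
    Δ x A = Δ[_∣_] f x A

  f+Δ≈f∪ : ∀ A x → f A +ℝ Δ x A ≈ℝ f (A ∪ ⁅ x ⁆)
  f+Δ≈f∪ A x = x+[y-x]≈y (f A) (f (A ∪ ⁅ x ⁆))

  -- Submodularity only speaks of x ∉ B; for x ∈ B the marginal at B vanishes.
  f∪≤f+Δ : ∀ {A B} → A ⊆ B → ∀ x → f (B ∪ ⁅ x ⁆) ≤ℝ f B +ℝ Δ x A
  f∪≤f+Δ {A} {B} A⊆B x with x ∈? B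
  ... | no x∉B = begin
    f (B ∪ ⁅ x ⁆)   ≈⟨ f+Δ≈f∪ B x ⟨
    f B +ℝ Δ x B    ≲⟨ +ℝ-monoʳ-≤ (f B) (Δ x B) (Δ x A) (submod A B A⊆B x x∉B) ⟩
    f B +ℝ Δ x A    ∎
  ... | yes x∈B = begin
    f (B ∪ ⁅ x ⁆)   ≲⟨ mono _ B (∪-lub id (⁅⁆⊆ x∈B)) ⟩
    -- The vanishing marginal is written as `f A -ℝ f A`, which monotonicity bounds by `Δ x A`.
    f B             ≈⟨ pointwise⇒≈ℝ (f B) (f B +ℝ (f A -ℝ f A)) (λ n →
                         solve 2 (λ a b → b := b :+ (a :- a))
                           refl (seq (f A) n) (seq (f B) n)) ⟩
    f B +ℝ (f A -ℝ f A)
      ≲⟨ +ℝ-monoʳ-≤ (f B) (f A -ℝ f A) (Δ x A)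
           (+ℝ-monoˡ-≤ (-ℝ f A) (f A) (f (A ∪ ⁅ x ⁆))
             (mono A _ (p⊆p∪q ⁅ x ⁆))) ⟩
    f B +ℝ Δ x A    ∎

  -- Diminishing marginals without the proviso `x ∉ B`: an optimal choice may already lie among the
  -- greedy ones.
  Δ-antitone : ∀ {A B} → A ⊆ B → ∀ x → Δ x B ≤ℝ Δ x A
  Δ-antitone {A} {B} A⊆B x = begin
    Δ x B
      ≲⟨ +ℝ-monoˡ-≤ (-ℝ f B) (f (B ∪ ⁅ x ⁆)) (f B +ℝ Δ x A) (f∪≤f+Δ A⊆B x) ⟩
    (f B +ℝ Δ x A) -ℝ f B
      ≈⟨ pointwise⇒≈ℝ ((f B +ℝ Δ x A) -ℝ f B) (Δ x A) (λ n →
           solve 2 (λ b d → (b :+ d) :- b := d) refl (seq (f B) n) (seq (Δ x A) n)) ⟩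
    Δ x A ∎

  -- The points are added one at a time, and each marginal at the enlarged set is at most the
  -- marginal at `S`.
  f∪setOf≤f+∑Δ : ∀ {ι : Set} (y : ι → Fin m) (is : List ι) S →
    f (S ∪ setOf (map y is)) ≤ℝ f S +ℝ ∑ (λ i → Δ (y i) S) is
  f∪setOf≤f+∑Δ y [] S = begin
    f (S ∪ ∅)   ≡⟨ cong f (∪-identityʳ S) ⟩
    f S         ≈⟨ +ℝ-identityʳ (f S) ⟨
    f S +ℝ 0ℝ   ∎
  f∪setOf≤f+∑Δ y (i ∷ is) S = begin
    f (S ∪ (⁅ y i ⁆ ∪ R))
      -- Regrouping makes the head of the list the last point added.
      ≡⟨ cong f (trans (cong (S ∪_) (∪-comm ⁅ y i ⁆ R)) (sym (∪-assoc S R ⁅ y i ⁆))) ⟩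
    f ((S ∪ R) ∪ ⁅ y i ⁆)
      ≲⟨ f∪≤f+Δ (p⊆p∪q R) (y i) ⟩
    f (S ∪ R) +ℝ d
      ≲⟨ +ℝ-monoˡ-≤ d (f (S ∪ R)) (f S +ℝ D) (f∪setOf≤f+∑Δ y is S) ⟩
    (f S +ℝ D) +ℝ d
      ≈⟨ pointwise⇒≈ℝ ((f S +ℝ D) +ℝ d) (f S +ℝ (d +ℝ D)) (λ n →
           solve 3 (λ s D d → (s :+ D) :+ d := s :+ (d :+ D))
             refl (seq (f S) n) (seq D n) (seq d n)) ⟩
    f S +ℝ (d +ℝ D) ∎
    where
    R = setOf (map y is)
    d = Δ (y i) S
    D = ∑ (λ i → Δ (y i) S) is

  -- A marginal is largest at `∅`, where it is at most the value of the singleton. This pays for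
  -- each vertex outside the clique.
  Δ≤f : NonNegative f → ∀ {A x S} → x ∈ S → Δ x A ≤ℝ f S
  Δ≤f nonneg {A} {x} {S} x∈S = begin
    Δ x A
      ≲⟨ Δ-antitone (⊆-min A) x ⟩
    f (∅ ∪ ⁅ x ⁆) -ℝ f ∅
      ≲⟨ +ℝ-mono-≤ (f (∅ ∪ ⁅ x ⁆)) (f S) (-ℝ f ∅) 0ℝ
           (mono _ S (∪-lub (⊆-min S) (⁅⁆⊆ x∈S))) -f∅≤0 ⟩
    f S +ℝ 0ℝ
      ≈⟨ +ℝ-identityʳ (f S) ⟩
    f S ∎
    where
    -f∅≤0 : -ℝ f ∅ ≤ℝ 0ℝ
    -f∅≤0 = begin
      -ℝ f ∅             ≈⟨ pointwise⇒≈ℝ (-ℝ f ∅) (0ℝ -ℝ f ∅) (λ n →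
                              sym (ℚ.+-identityˡ (ℚ.- seq (f ∅) n))) ⟩
      0ℝ -ℝ f ∅          ≲⟨ +ℝ-monoˡ-≤ (-ℝ f ∅) 0ℝ (f ∅) (nonneg ∅) ⟩
      f ∅ -ℝ f ∅         ≈⟨ pointwise⇒≈ℝ (f ∅ -ℝ f ∅) 0ℝ (λ n →
                              ℚ.+-inverseʳ (seq (f ∅) n)) ⟩
      0ℝ                 ∎

  -- A collects the clique choices already made, so that f A accounts for the
  -- telescoped marginals of the clique.
  f+∑Δ≤ : NonNegative f → ∀ {n} (x : Fin n → Fin m) (In : Fin n → Subset m)
    (C : Subset n) (S : Subset m) → (∀ i → x i ∈ S) →
    (∀ {i j} → i ∈ C → j ∈ C → i < j → x i ∈ In j) →
    ∀ is → AllPairs _<_ is →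
    ∀ A → A ⊆ S → (∀ {j} → j ∈ˡ is → j ∈ C → A ⊆ In j) →
    f A +ℝ ∑ (λ i → Δ (x i) (In i)) is ≤ℝ
      suc (length (filter (λ i → ¬? (i ∈? C)) is)) · f S
  f+∑Δ≤ nonneg x In C S x∈S earlier = go
    where
    D : List _ → ℝ
    D = ∑ (λ i → Δ (x i) (In i))

    go : ∀ is → AllPairs _<_ is →
      ∀ A → A ⊆ S → (∀ {j} → j ∈ˡ is → j ∈ C → A ⊆ In j) →
      f A +ℝ D is ≤ℝ suc (length (filter (λ i → ¬? (i ∈? C)) is)) · f S
    -- All clique marginals have been absorbed into `f A`; the one copy of `f S` from the leading
    -- `suc` covers it.
    go [] _ A A⊆S _ = +ℝ-monoˡ-≤ 0ℝ (f A) (f S) (mono A S A⊆S)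
    go (i ∷ is) (i< ∷ sorted) A A⊆S A⊆In with i ∈? C
    -- Since `A ⊆ In i`, replacing `In i` by `A` only raises the marginal, which then merges with
    -- `f A`. The filter drops `i`, so the bound is unchanged.
    ... | yes i∈C = begin
      f A +ℝ (Δ (x i) (In i) +ℝ D is)
        ≈⟨ +ℝ-assoc (f A) (Δ (x i) (In i)) (D is) ⟨
      (f A +ℝ Δ (x i) (In i)) +ℝ D is
        ≲⟨ +ℝ-monoˡ-≤ (D is) (f A +ℝ Δ (x i) (In i)) (f A +ℝ Δ (x i) A)
             (+ℝ-monoʳ-≤ (f A) (Δ (x i) (In i)) (Δ (x i) A)
               (Δ-antitone (A⊆In (Any.here refl) i∈C) (x i))) ⟩
      (f A +ℝ Δ (x i) A) +ℝ D is
        ≲⟨ +ℝ-monoˡ-≤ (D is) (f A +ℝ Δ (x i) A) (f (A ∪ ⁅ x i ⁆))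
             (proj₁ (f+Δ≈f∪ A (x i))) ⟩
      f (A ∪ ⁅ x i ⁆) +ℝ D is
        ≲⟨ go is sorted (A ∪ ⁅ x i ⁆) (∪-lub A⊆S (⁅⁆⊆ (x∈S i)))
             -- The list is sorted, so every remaining clique vertex `j` exceeds `i`, and `earlier`
             -- keeps the enlarged set inside `In j`.
             (λ j∈ j∈C → ∪-lub (A⊆In (Any.there j∈) j∈C)
               (⁅⁆⊆ (earlier i∈C j∈C (lookup i< j∈)))) ⟩
      suc (length (filter (λ i → ¬? (i ∈? C)) is)) · f S ∎
    -- The filter keeps `i`, and the extra copy of `f S` pays for its marginal; `A` stays the same.
    ... | no i∉C = begin
      f A +ℝ (Δ (x i) (In i) +ℝ D is)
        ≈⟨ pointwise⇒≈ℝ (f A +ℝ (Δ (x i) (In i) +ℝ D is))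
             (Δ (x i) (In i) +ℝ (f A +ℝ D is)) (λ n →
             solve 3 (λ a d D → a :+ (d :+ D) := d :+ (a :+ D)) refl
               (seq (f A) n) (seq (Δ (x i) (In i)) n) (seq (D is) n)) ⟩
      Δ (x i) (In i) +ℝ (f A +ℝ D is)
        ≲⟨ +ℝ-mono-≤ (Δ (x i) (In i)) (f S) (f A +ℝ D is)
             (suc (length (filter (λ i → ¬? (i ∈? C)) is)) · f S)
             (Δ≤f nonneg (x∈S i))
             (go is sorted A A⊆S (A⊆In ∘ Any.there)) ⟩
      f S +ℝ suc (length (filter (λ i → ¬? (i ∈? C)) is)) · f S ∎

-- The approximation guarantee for greedy choices

mainTheorem2 : ∀ {m n : ℕ}
    (X : Fin n → Subset m) → IsPartition X →
    (f : SetFunction m) →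
    NonNegative f → Normalized f → Monotone f → Submodular f →
    (G : DAG n) → (∀ {i j} → Edge G i j → i < j) →
    (x* : Fin n → Fin m) → IsOptimal f X x* →
    (x : Fin n → Fin m) → IsGreedy f X G x →
    (ω : ℕ) → IsCliqueNumber G ω →
    value f x ≥ℝ fromℚ (+ 1 / (2 + (n ∸ ω))) *ℝ value f x*
-- Matching on `refl` makes `ω` the size of a vertex subset, so `n ∸ ω` is the true difference. The
-- 2 in the denominator counts one `f S` from adding `O` to `S` and one from the clique.
mainTheorem2 {m} {n} X _ f nonneg _ mono submod G E⇒< x* (x*∈X , _) x greedy
  ω ((K , refl) , _) = ≤·⇒1/*≤ (suc (n ∸ ω)) (value f x*) (f S) (begin
    f O
      ≲⟨ mono O (S ∪ O) (q⊆p∪q S O) ⟩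
    f (S ∪ O)
      ≲⟨ f∪setOf≤f+∑Δ f mono submod x* (allFin n) S ⟩
    f S +ℝ ∑ (λ i → Δ (x* i) S) (allFin n)
      ≲⟨ +ℝ-monoʳ-≤ (f S) (∑ (λ i → Δ (x* i) S) (allFin n)) D
           (∑-mono (allFin n) Δ*≤Δ) ⟩
    f S +ℝ D
      ≲⟨ +ℝ-monoʳ-≤ (f S) D (suc (n ∸ ω) · f S) D≤ ⟩
    f S +ℝ suc (n ∸ ω) · f S ∎)
  where
  S = setOf (map x (allFin n))
  O = setOf (map x* (allFin n))
  C = vertices (Clique.subgraph K)

  Δ : Fin m → Subset m → ℝ
  Δ z A = Δ[_∣_] f z A

  D = ∑ (λ i → Δ (x i) (X-in G x i)) (allFin n)

  x∈S : ∀ i → x i ∈ S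
  x∈S i = ∈-setOf (∈-map⁺ x (∈-allFin i))

  X-in⊆S : ∀ i → X-in G x i ⊆ S
  X-in⊆S i = go (filter (λ j → edge? G j i) (allFin n))
    where
    go : ∀ js → setOf (map x js) ⊆ S
    go []       = ⊆-min S
    go (j ∷ js) = ∪-lub (⁅⁆⊆ (x∈S j)) (go js)

  Δ*≤Δ : ∀ i → Δ (x* i) S ≤ℝ Δ (x i) (X-in G x i)
  Δ*≤Δ i = begin
    Δ (x* i) S              ≲⟨ Δ-antitone f mono submod (X-in⊆S i) (x* i) ⟩
    Δ (x* i) (X-in G x i)   ≲⟨ proj₂ (greedy i) (x* i) (x*∈X i) ⟩
    Δ (x i) (X-in G x i)    ∎

  D≤ : D ≤ℝ suc (n ∸ ω) · f S
  D≤ = begin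
    D
      -- The telescoping starts at `A = ∅`, so a leading `f ∅` is brought in by way of `0 ≤ f ∅`.
      ≈⟨ pointwise⇒≈ℝ D (0ℝ +ℝ D) (λ k → sym (ℚ.+-identityˡ (seq D k))) ⟩
    0ℝ +ℝ D
      ≲⟨ +ℝ-monoˡ-≤ D 0ℝ (f ∅) (nonneg ∅) ⟩
    f ∅ +ℝ D
      ≲⟨ f+∑Δ≤ f mono submod nonneg x (X-in G x) C S x∈S
           -- Between clique vertices `i < j` there is an edge, which puts `x i` into `X-in G x j`.
           (λ i∈C j∈C i<j → ∈-setOf (∈-map⁺ x
             (∈-filter⁺ (λ i → edge? G i _) (∈-allFin _)
               (clique-edge E⇒< K i∈C j∈C i<j))))
           (allFin n) (AllPairs.tabulate⁺-< id) ∅ (⊆-min S)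
           (λ _ _ → ⊆-min _) ⟩
    suc (length (filter (λ i → ¬? (i ∈? C)) (allFin n))) · f S
      ≡⟨ cong (λ k → suc k · f S) (∣allFin∖∣≡n∸∣∣ C) ⟩
    suc (n ∸ ω) · f S ∎
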